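{- For every integer $k \ge 1$, there exists a quasi-perfect $1$-error-correcting code in each of the following Cartesian products: (1) $C_6 \square C_6 \square C_{3k}$; (2) $C_n \square C_n \square C_{3k}$ for every $n$ with $8 \le n \le 12$; (3) $C_n \square C_n \square C_n$ for every $n$ with $8 \le n \le 12$.
   Context: All graphs are simple and connected; $d(x,y)$ is the shortest-path distance. For $n\ge 3$, $C_n$ is the cycle on $n$ vertices. The Cartesian product $G\square H$ has vertex set $V(G)\times V(H)$, with $(g_1,h_1)$ adjacent to $(g_2,h_2)$ iff either $h_1=h_2$ and $g_1g_2\in E(G)$, or $g_1=g_2$ and $h_1h_2\in E(H)$. A code is a subset $D$ of the vertex set. $D$ is $t$-error-correcting if any two distinct codewords are at distance at least $2t+1$. The covering radius of $D$ is the smallest $r$ such that every vertex is at distance at most $r$ from some codeword. A quasi-perfect $t$-error-correcting code is a $t$-error-correcting code with covering radius $t+1$. -}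

module Defs where

open import Data.Nat using (ℕ; zero; suc; _+_; _*_; _≤_; _<_)
open import Data.Fin using (Fin; toℕ)
open import Data.Product using (Σ; ∃; _×_; _,_)
open import Data.Sum using (_⊎_)
open import Data.Empty using (⊥)
open import Relation.Nullary using (¬_)
open import Relation.Binary.PropositionalEquality using (_≡_; _≢_)

record Graph : Set₁ where
  field
    V   : Set
    Adj : V → V → Set
open Graph public

data Walk (G : Graph) : V G → V G → ℕ → Set where
  here : ∀ {x} → Walk G x x zero
  step : ∀ {x y z ℓ} → Adj G x y → Walk G y z ℓ → Walk G x z (suc ℓ)

DistLe : (G : Graph) → V G → V G → ℕ → Set
DistLe G x y r = Σ ℕ λ ℓ → ℓ ≤ r × Walk G x y ℓ

-- Cycle C_n on vertex set ℤ/n = Fin n: i ~ j iff j ≡ i+1 or i ≡ j+1 (mod n).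
CycleAdj : (n : ℕ) → Fin n → Fin n → Set
CycleAdj n i j = (suc (toℕ i) ≡ toℕ j ⊎ (suc (toℕ i) ≡ n × toℕ j ≡ 0))
               ⊎ (suc (toℕ j) ≡ toℕ i ⊎ (suc (toℕ j) ≡ n × toℕ i ≡ 0))

C : ℕ → Graph
C n = record { V = Fin n ; Adj = CycleAdj n }

_□_ : Graph → Graph → Graph
G □ H = record
  { V   = V G × V H
  ; Adj = λ { (g₁ , h₁) (g₂ , h₂) →
              (h₁ ≡ h₂ × Adj G g₁ g₂) ⊎ (g₁ ≡ g₂ × Adj H h₁ h₂) } }
infixr 6 _□_

Code : Graph → Set₁
Code G = V G → Set

-- t-error-correcting: distinct codewords are at distance ≥ 2t+1,
-- i.e. not at distance ≤ 2t.
ErrorCorrecting : (G : Graph) → ℕ → Code G → Set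
ErrorCorrecting G t D =
  ∀ x y → D x → D y → x ≢ y → ¬ DistLe G x y (2 * t)

Covers : (G : Graph) → Code G → ℕ → Set
Covers G D r = ∀ v → Σ (V G) λ c → D c × DistLe G c v r

CoveringRadius : (G : Graph) → Code G → ℕ → Set
CoveringRadius G D r = Covers G D r × (∀ r′ → r′ < r → ¬ Covers G D r′)

QuasiPerfect : (G : Graph) → ℕ → Code G → Set
QuasiPerfect G t D = ErrorCorrecting G t D × CoveringRadius G D (suc t)

HasQuasiPerfect1Code : Graph → Set₁
HasQuasiPerfect1Code G = Σ (Code G) λ D → QuasiPerfect G 1 D

{-# OPTIONS --safe #-}

-- Label the vertex (x , y , z) of C n □ C n □ C l by its syndrome
-- (x + 2y + cz mod n , z mod q), where n ∣ cl and q ∣ l.  Moving to a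
-- neighbour changes the syndrome by one of ±(1 , 0), ±(2 , 0), ±(c , 1), so
-- for a code that is the preimage of a set K of syndromes, being
-- quasi-perfect is a finite condition on K in ℤ/n × ℤ/q.  For C n □ C n □ C n
-- take c = 3, q = 1 and K = {0}: for 8 ≤ n ≤ 13 the residues 0, ±1, ±2, ±3 are
-- distinct and do not exhaust ℤ/n, but their pairwise sums do.  For
-- C n □ C n □ C (3k) take c = 0, q = 3, and for K a maximal set whose elements
-- are at distance at least 5 in ℤ/n within a layer, and at least 3 across layers.
module Submission where

open import Defs
open import Data.Nat using (ℕ; suc; pred; _+_; _*_; _≤_; _<_; z≤n; s≤s; NonZero)
open import Data.Nat.Properties using (+-comm; +-assoc; +-cancelˡ-≤; *-identityˡ; *-distribˡ-+; ≤-trans; ≤∧≢⇒<; m≤n⇒∃[o]m+o≡n; suc-pred) renaming (_≟_ to _≟ℕ_)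
open import Data.Nat.Divisibility using (_∣_; n∣m*n; m∣m*n; ∣m⇒∣m*n; 1∣_; _∣0)
open import Data.Nat.DivMod using (_%_; _/_; _mod_; m%n<n; %-distribˡ-+; m%n%n≡m%n; [m+kn]%n≡m%n; n%n≡0; m<n⇒m%n≡m; m≡m%n+[m/n]*n; %-remove-+ʳ)
open import Data.Nat.Tactic.RingSolver using (solve-∀)
open import Data.Fin using (Fin; zero; suc; toℕ; opposite)
open import Data.Fin.Properties using (toℕ-injective; toℕ-fromℕ<; toℕ<n; all?; any?) renaming (_≟_ to _≟ᶠ_)
open import Data.Product using (∃; _×_; _,_; proj₁; proj₂)
open import Data.Product.Properties using (≡-dec)
open import Data.Sum using (_⊎_; inj₁; inj₂)
open import Data.List using (List; []; _∷_)
open import Data.List.Membership.Propositional using (_∈_)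
open import Data.List.Membership.DecPropositional (≡-dec _≟ℕ_ _≟ℕ_) using (_∈?_)
open import Relation.Nullary using (¬_; Dec; yes; no)
open import Relation.Nullary.Decidable using (True; toWitness; map′; _×-dec_; _⊎-dec_; _→-dec_; ¬?)
open import Relation.Binary.PropositionalEquality using (_≡_; refl; sym; trans; cong; cong₂; subst; module ≡-Reasoning)

-- Codes pulled back along a syndrome

-- The moves `I` list the neighbours of all vertices uniformly, and `syn-nbr` makes `syn`
-- equivariant, so walks in `G` project to sequences of moves on `S`.
record Syndrome (G : Graph) (I S : Set) : Set where
  field
    nbr      : I → V G → V G
    inv      : I → I
    nbr-inv  : ∀ i v → nbr (inv i) (nbr i v) ≡ v
    nbr-adj  : ∀ i v → Adj G (nbr i v) v
    adj-nbr  : ∀ u v → Adj G u v → ∃ λ i → u ≡ nbr i v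
    syn      : V G → S
    move     : I → S → S
    syn-nbr  : ∀ i v → syn (nbr i v) ≡ move i (syn v)

module _ {I S : Set} (inv : I → I) (move : I → S → S) (P : S → Set) where

  -- The second clause asks for `j ≡ inv i`, not just for a return to `s`: two moves that restore
  -- the syndrome without cancelling may lead to a different vertex, which is again a codeword.
  Separated : S → Set
  Separated s = P s → (∀ i → ¬ P (move i s))
                    × (∀ i j → P (move j (move i s)) → j ≡ inv i)

module _ {I S : Set} (move : I → S → S) (P : S → Set) where

  Covered₁ : S → Set
  Covered₁ s = P s ⊎ ∃ λ i → P (move i s)

  Covered₂ : S → Set
  Covered₂ s = Covered₁ s ⊎ ∃ λ i → ∃ λ j → P (move j (move i s))

module _ {G : Graph} {I S : Set} (σ : Syndrome G I S) (P : S → Set) where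
  open Syndrome σ

  pullback : Code G
  pullback v = P (syn v)

  syn-nbr² : ∀ i j v → syn (nbr j (nbr i v)) ≡ move j (move i (syn v))
  syn-nbr² i j v = trans (syn-nbr j (nbr i v)) (cong (move j) (syn-nbr i v))

  pullback-errorCorrecting : (∀ s → Separated inv move P s) → ErrorCorrecting G 1 pullback
  pullback-errorCorrecting sep x y px py x≢y (_ , _ , here) = x≢y refl
  pullback-errorCorrecting sep x y px py x≢y (_ , _ , step a here)
    with adj-nbr x y a
  ... | i , refl = proj₁ (sep (syn y) py) i (subst P (syn-nbr i y) px)
  pullback-errorCorrecting sep x z px pz x≢z (_ , _ , step {y = y} a (step b here))
    with adj-nbr y z b
  ... | i , refl with adj-nbr x (nbr i z) a
  -- Here `x` is two moves away from the codeword `z`; the moves must cancel, and then `nbr-inv`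
  -- identifies `x` with `z`.
  ... | j , refl with proj₂ (sep (syn z) pz) i j (subst P (syn-nbr² i j z) px)
  ... | refl = x≢z (nbr-inv i z)
  pullback-errorCorrecting sep x y px py x≢y (_ , s≤s (s≤s ()) , step _ (step _ (step _ _)))

  pullback-covers : (∀ s → Covered₂ move P s) → Covers G pullback 2
  pullback-covers cov v with cov (syn v)
  ... | inj₁ (inj₁ p) = v , p , 0 , z≤n , here
  ... | inj₁ (inj₂ (i , p)) =
    nbr i v , subst P (sym (syn-nbr i v)) p , 1 , s≤s z≤n , step (nbr-adj i v) here
  ... | inj₂ (i , j , p) =
    nbr j (nbr i v) , subst P (sym (syn-nbr² i j v)) p ,
    2 , s≤s (s≤s z≤n) , step (nbr-adj j (nbr i v)) (step (nbr-adj i v) here)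

  -- Every edge is a move, so balls of radius 1 can be read off from syndromes. This serves to bound
  -- the covering radius from below.
  ball⇒Covered₁ : ∀ c v → pullback c → DistLe G c v 1 → Covered₁ move P (syn v)
  ball⇒Covered₁ c v pc (_ , _ , here) = inj₁ pc
  ball⇒Covered₁ c v pc (_ , _ , step a here) with adj-nbr c v a
  ... | i , refl = inj₂ (i , subst P (syn-nbr i v) pc)
  ball⇒Covered₁ c v pc (_ , s≤s () , step _ (step _ _))

  -- The uncovered point is given as a vertex, since `syn` is not assumed to be onto.
  pullback-quasiPerfect : (∀ s → Separated inv move P s) →
                          (∀ s → Covered₂ move P s) →
                          (∃ λ v → ¬ Covered₁ move P (syn v)) →
                          QuasiPerfect G 1 pullback
  pullback-quasiPerfect sep cov (v , unc) =
    pullback-errorCorrecting sep , pullback-covers cov , not-perfect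
    where
    not-perfect : ∀ r → r < 2 → ¬ Covers G pullback r
    -- Radii 0 and 1 are refuted together, by enlarging `r` to 1.
    not-perfect r (s≤s r≤1) cov₁ with cov₁ v
    ... | c , pc , ℓ , ℓ≤r , w = unc (ball⇒Covered₁ c v pc (ℓ , ≤-trans ℓ≤r r≤1 , w))

-- Rotations of a cycle

toℕ-mod : ∀ m n .{{_ : NonZero n}} → toℕ (m mod n) ≡ m % n
toℕ-mod m n = toℕ-fromℕ< (m%n<n m n)

[m%n+k]%n≡[m+k]%n : ∀ m k n .{{_ : NonZero n}} → (m % n + k) % n ≡ (m + k) % n
[m%n+k]%n≡[m+k]%n m k n = begin
  (m % n + k) % n          ≡⟨ %-distribˡ-+ (m % n) k n ⟩
  (m % n % n + k % n) % n  ≡⟨ cong (λ u → (u + k % n) % n) (m%n%n≡m%n m n) ⟩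
  (m % n + k % n) % n      ≡⟨ %-distribˡ-+ m k n ⟨
  (m + k) % n              ∎
  where open ≡-Reasoning

mod-cong : ∀ {m m′} n .{{_ : NonZero n}} → m % n ≡ m′ % n → m mod n ≡ m′ mod n
mod-cong {m} {m′} n eq = toℕ-injective (trans (toℕ-mod m n) (trans eq (sym (toℕ-mod m′ n))))

module _ {n : ℕ} .{{_ : NonZero n}} where

  rot : ℕ → Fin n → Fin n
  rot a x = (toℕ x + a) mod n

  -- Sign 0 is forwards and sign 1 is backwards; -1 is represented by n - 1.
  unit : Fin 2 → ℕ
  unit zero       = 1
  unit (suc zero) = pred n

  spin : ℕ → Fin 2 → Fin n → Fin n
  spin a σ = rot (a * unit σ)

  rot-mod : ∀ a m → rot a (m mod n) ≡ (m + a) mod n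
  rot-mod a m = mod-cong n (trans (cong (λ u → (u + a) % n) (toℕ-mod m n)) ([m%n+k]%n≡[m+k]%n m a n))

  toℕ-mod-id : (x : Fin n) → toℕ x mod n ≡ x
  toℕ-mod-id x = toℕ-injective (trans (toℕ-mod (toℕ x) n) (m<n⇒m%n≡m (toℕ<n x)))

  rot-full : ∀ a b c x → a + b ≡ c * n → rot b (rot a x) ≡ x
  rot-full a b c x eq = begin
    rot b (rot a x)           ≡⟨ rot-mod b (toℕ x + a) ⟩
    (toℕ x + a + b) mod n     ≡⟨ cong (_mod n) (trans (+-assoc (toℕ x) a b) (cong (toℕ x +_) eq)) ⟩
    (toℕ x + c * n) mod n     ≡⟨ mod-cong n ([m+kn]%n≡m%n (toℕ x) c n) ⟩
    toℕ x mod n               ≡⟨ toℕ-mod-id x ⟩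
    x                         ∎
    where open ≡-Reasoning

  unit-sum : ∀ σ → unit σ + unit (opposite σ) ≡ n
  unit-sum zero       = suc-pred n
  unit-sum (suc zero) = trans (+-comm (pred n) 1) (suc-pred n)

  -- The forward and backward amounts add up to `a * n`, that is, to `a` full turns.
  spin-inv : ∀ a σ x → spin a (opposite σ) (spin a σ x) ≡ x
  spin-inv a σ x = rot-full (a * unit σ) (a * unit (opposite σ)) a x
    (trans (sym (*-distribˡ-+ a (unit σ) (unit (opposite σ)))) (cong (a *_) (unit-sum σ)))

  toℕ-next : ∀ x → toℕ (spin 1 zero x) ≡ (toℕ x + 1) % n
  toℕ-next x = toℕ-mod (toℕ x + 1) n

  -- `CycleAdj n x y` unfolds to `Next x y ⊎ Next y x`, so only the forward direction needs
  -- arithmetic.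
  Next : Fin n → Fin n → Set
  Next x y = suc (toℕ x) ≡ toℕ y ⊎ (suc (toℕ x) ≡ n × toℕ y ≡ 0)

  toℕ-next-wrap : ∀ x → suc (toℕ x) ≡ n → toℕ (spin 1 zero x) ≡ 0
  toℕ-next-wrap x eq = begin
    toℕ (spin 1 zero x)  ≡⟨ toℕ-next x ⟩
    (toℕ x + 1) % n      ≡⟨ cong (_% n) (trans (+-comm (toℕ x) 1) eq) ⟩
    n % n                ≡⟨ n%n≡0 n ⟩
    0                    ∎
    where open ≡-Reasoning

  toℕ-next-< : ∀ x → suc (toℕ x) < n → toℕ (spin 1 zero x) ≡ suc (toℕ x)
  toℕ-next-< x lt = begin
    toℕ (spin 1 zero x)  ≡⟨ toℕ-next x ⟩
    (toℕ x + 1) % n      ≡⟨ cong (_% n) (+-comm (toℕ x) 1) ⟩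
    suc (toℕ x) % n      ≡⟨ m<n⇒m%n≡m lt ⟩
    suc (toℕ x)          ∎
    where open ≡-Reasoning

  Next-spin : ∀ x → Next x (spin 1 zero x)
  Next-spin x with suc (toℕ x) ≟ℕ n
  ... | yes eq = inj₂ (eq , toℕ-next-wrap x eq)
  ... | no neq = inj₁ (sym (toℕ-next-< x (≤∧≢⇒< (toℕ<n x) neq)))

  Next⇒spin : ∀ x y → Next x y → y ≡ spin 1 zero x
  Next⇒spin x y (inj₁ eq) =
    toℕ-injective (trans (sym eq) (sym (toℕ-next-< x (subst (_< n) (sym eq) (toℕ<n y)))))
  Next⇒spin x y (inj₂ (eq , y≡0)) = toℕ-injective (trans y≡0 (sym (toℕ-next-wrap x eq)))

  spin-adj : ∀ σ x → CycleAdj n (spin 1 σ x) x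
  spin-adj zero       x = inj₂ (Next-spin x)
  spin-adj (suc zero) x =
    -- Stepping forward from the backward neighbour returns to `x`.
    inj₁ (subst (Next (spin 1 (suc zero) x)) (spin-inv 1 (suc zero) x) (Next-spin (spin 1 (suc zero) x)))

  adj-spin : ∀ x y → CycleAdj n x y → ∃ λ σ → x ≡ spin 1 σ y
  -- The sign describes the move from `y` to `x`, so it is backwards when `y` follows `x`.
  adj-spin x y (inj₁ xy) = suc zero ,
    trans (sym (spin-inv 1 zero x)) (cong (spin 1 (suc zero)) (sym (Next⇒spin x y xy)))
  adj-spin x y (inj₂ yx) = zero , Next⇒spin y x yx

-- Affine maps between cycles

module _ {n l : ℕ} .{{_ : NonZero n}} .{{_ : NonZero l}} (a : ℕ) (n∣al : n ∣ a * l) (r : ℕ) where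

  affine : Fin l → Fin n
  affine x = (r + a * toℕ x) mod n

  -- Where `x` wraps from `l - 1` to 0, the unreduced value jumps by `a * l`, which `n∣al` makes
  -- invisible modulo `n`.
  affine-next : ∀ x → affine (spin 1 zero x) ≡ spin a zero (affine x)
  affine-next x = begin
    (r + a * toℕ (spin 1 zero x)) mod n    ≡⟨ cong (λ u → (r + a * u) mod n) (toℕ-next x) ⟩
    (r + a * (x′ % l)) mod n               ≡⟨ mod-cong n (%-remove-+ʳ (r + a * (x′ % l)) (∣m⇒∣m*n (x′ / l) n∣al)) ⟨
    (r + a * (x′ % l) + a * l * (x′ / l)) mod n
                                           ≡⟨ cong (_mod n) (regroup r a l (x′ % l) (x′ / l)) ⟩
    (r + a * (x′ % l + x′ / l * l)) mod n  ≡⟨ cong (λ u → (r + a * u) mod n) (m≡m%n+[m/n]*n x′ l) ⟨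
    (r + a * x′) mod n                     ≡⟨ cong (_mod n) (expand r a (toℕ x)) ⟩
    (r + a * toℕ x + a * 1) mod n          ≡⟨ rot-mod (a * 1) (r + a * toℕ x) ⟨
    spin a zero (affine x)                 ∎
    where
    open ≡-Reasoning
    x′ : ℕ
    x′ = toℕ x + 1
    regroup : ∀ r a l u v → r + a * u + a * l * v ≡ r + a * (u + v * l)
    regroup = solve-∀
    expand : ∀ r a u → r + a * (u + 1) ≡ r + a * u + a * 1
    expand = solve-∀

  affine-spin : ∀ σ x → affine (spin 1 σ x) ≡ spin a σ (affine x)
  affine-spin zero       x = affine-next x
  affine-spin (suc zero) x = begin
    -- The backward rule is the forward rule at the predecessor `y` of `x`, with the rotation
    -- cancelled.
    affine y                                     ≡⟨ spin-inv a zero (affine y) ⟨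
    spin a (suc zero) (spin a zero (affine y))   ≡⟨ cong (spin a (suc zero)) (affine-next y) ⟨
    spin a (suc zero) (affine (spin 1 zero y))   ≡⟨ cong (λ u → spin a (suc zero) (affine u)) (spin-inv 1 (suc zero) x) ⟩
    spin a (suc zero) (affine x)                 ∎
    where
    open ≡-Reasoning
    y : Fin l
    y = spin 1 (suc zero) x

-- The linear syndrome on C n □ C n □ C l

Move : Set
Move = Fin 3 × Fin 2

reverse : Move → Move
reverse (axis , σ) = axis , opposite σ

module _ (n q c : ℕ) .{{_ : NonZero n}} .{{_ : NonZero q}} where

  shift : Move → Fin n × Fin q → Fin n × Fin q
  shift (zero           , σ) (s , t) = spin 1 σ s , t
  shift (suc zero       , σ) (s , t) = spin 2 σ s , t
  shift (suc (suc zero) , σ) (s , t) = spin c σ s , spin 1 σ t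

  module _ (l : ℕ) .{{_ : NonZero l}} (n∣cl : n ∣ c * l) (q∣l : q ∣ l) where

    Torus : Graph
    Torus = C n □ C n □ C l

    neighbour : Move → V Torus → V Torus
    neighbour (zero           , σ) (x , y , z) = spin 1 σ x , y , z
    neighbour (suc zero       , σ) (x , y , z) = x , spin 1 σ y , z
    neighbour (suc (suc zero) , σ) (x , y , z) = x , y , spin 1 σ z

    syndrome : V Torus → Fin n × Fin q
    syndrome (x , y , z) = (toℕ x + 2 * toℕ y + c * toℕ z) mod n , toℕ z mod q

    -- With the other coordinates frozen into a constant, the first component is affine in the
    -- coordinate that moves, with slope 1, 2 or `c`.
    syndrome-neighbour : ∀ i v → syndrome (neighbour i v) ≡ shift i (syndrome v)
    syndrome-neighbour (zero , σ) (x , y , z) = cong (_, toℕ z mod q) (begin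
      (toℕ (spin 1 σ x) + 2 * toℕ y + c * toℕ z) mod n  ≡⟨ cong (_mod n) (last (toℕ (spin 1 σ x)) (toℕ y) c (toℕ z)) ⟩
      affine 1 (n∣m*n 1) r (spin 1 σ x)                 ≡⟨ affine-spin 1 (n∣m*n 1) r σ x ⟩
      spin 1 σ (affine 1 (n∣m*n 1) r x)                 ≡⟨ cong (λ u → spin 1 σ (u mod n)) (last (toℕ x) (toℕ y) c (toℕ z)) ⟨
      spin 1 σ ((toℕ x + 2 * toℕ y + c * toℕ z) mod n)  ∎)
      where
      open ≡-Reasoning
      r : ℕ
      r = 2 * toℕ y + c * toℕ z
      last : ∀ x y c z → x + 2 * y + c * z ≡ 2 * y + c * z + 1 * x
      last = solve-∀
    syndrome-neighbour (suc zero , σ) (x , y , z) = cong (_, toℕ z mod q) (begin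
      (toℕ x + 2 * toℕ (spin 1 σ y) + c * toℕ z) mod n  ≡⟨ cong (_mod n) (last (toℕ x) (toℕ (spin 1 σ y)) c (toℕ z)) ⟩
      affine 2 (n∣m*n 2) r (spin 1 σ y)                 ≡⟨ affine-spin 2 (n∣m*n 2) r σ y ⟩
      spin 2 σ (affine 2 (n∣m*n 2) r y)                 ≡⟨ cong (λ u → spin 2 σ (u mod n)) (last (toℕ x) (toℕ y) c (toℕ z)) ⟨
      spin 2 σ ((toℕ x + 2 * toℕ y + c * toℕ z) mod n)  ∎)
      where
      open ≡-Reasoning
      r : ℕ
      r = toℕ x + c * toℕ z
      last : ∀ x y c z → x + 2 * y + c * z ≡ x + c * z + 2 * y
      last = solve-∀
    syndrome-neighbour (suc (suc zero) , σ) (x , y , z) =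
      cong₂ _,_ (affine-spin c n∣cl (toℕ x + 2 * toℕ y) σ z) (begin
        -- The layer is itself an affine map, from `C l` to `C q`, with slope 1 and constant 0.
        toℕ (spin 1 σ z) mod q          ≡⟨ cong (_mod q) (*-identityˡ (toℕ (spin 1 σ z))) ⟨
        affine 1 q∣1l 0 (spin 1 σ z)    ≡⟨ affine-spin 1 q∣1l 0 σ z ⟩
        spin 1 σ (affine 1 q∣1l 0 z)    ≡⟨ cong (λ u → spin 1 σ (u mod q)) (*-identityˡ (toℕ z)) ⟩
        spin 1 σ (toℕ z mod q)          ∎)
      where
      open ≡-Reasoning
      q∣1l : q ∣ 1 * l
      q∣1l = subst (q ∣_) (sym (*-identityˡ l)) q∣l

    neighbour-inv : ∀ i v → neighbour (reverse i) (neighbour i v) ≡ v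
    neighbour-inv (zero           , σ) (x , y , z) = cong (_, y , z) (spin-inv 1 σ x)
    neighbour-inv (suc zero       , σ) (x , y , z) = cong (λ u → x , u , z) (spin-inv 1 σ y)
    neighbour-inv (suc (suc zero) , σ) (x , y , z) = cong (λ u → x , y , u) (spin-inv 1 σ z)

    neighbour-adj : ∀ i v → Adj Torus (neighbour i v) v
    neighbour-adj (zero           , σ) (x , y , z) = inj₁ (refl , spin-adj σ x)
    neighbour-adj (suc zero       , σ) (x , y , z) = inj₂ (refl , inj₁ (refl , spin-adj σ y))
    neighbour-adj (suc (suc zero) , σ) (x , y , z) = inj₂ (refl , inj₂ (refl , spin-adj σ z))

    adj-neighbour : ∀ u v → Adj Torus u v → ∃ λ i → u ≡ neighbour i v
    adj-neighbour (x , _) (x′ , _) (inj₁ (refl , a)) with adj-spin x x′ a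
    ... | σ , refl = (zero , σ) , refl
    adj-neighbour (_ , y , _) (_ , y′ , _) (inj₂ (refl , inj₁ (refl , a))) with adj-spin y y′ a
    ... | σ , refl = (suc zero , σ) , refl
    adj-neighbour (_ , _ , z) (_ , _ , z′) (inj₂ (refl , inj₂ (refl , a))) with adj-spin z z′ a
    ... | σ , refl = (suc (suc zero) , σ) , refl

    linear : Syndrome Torus Move (Fin n × Fin q)
    linear = record
      { nbr = neighbour ; inv = reverse ; nbr-inv = neighbour-inv
      ; nbr-adj = neighbour-adj ; adj-nbr = adj-neighbour
      ; syn = syndrome ; move = shift ; syn-nbr = syndrome-neighbour }

-- Deciding the conditions on a set of syndromes

×-all? : ∀ {m n} {P : Fin m × Fin n → Set} → (∀ x → Dec (P x)) → Dec (∀ x → P x)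
×-all? P? = map′ (λ f (a , b) → f a b) (λ f a b → f (a , b)) (all? λ a → all? λ b → P? (a , b))

×-any? : ∀ {m n} {P : Fin m × Fin n → Set} → (∀ x → Dec (P x)) → Dec (∃ P)
×-any? P? = map′ (λ (a , b , p) → (a , b) , p) (λ ((a , b) , p) → a , b , p)
                 (any? λ a → any? λ b → P? (a , b))

module _ (n q c : ℕ) .{{_ : NonZero n}} .{{_ : NonZero q}} (K : List (ℕ × ℕ)) where

  -- Syndromes are compared as pairs of numbers, so that one list `K` can serve several `n`.
  InK : Fin n × Fin q → Set
  InK (s , t) = (toℕ s , toℕ t) ∈ K

  InK? : ∀ s → Dec (InK s)
  InK? (s , t) = (toℕ s , toℕ t) ∈? K

  separated? : ∀ s → Dec (Separated reverse (shift n q c) InK s)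
  separated? s = InK? s →-dec
    (×-all? (λ i → ¬? (InK? (shift n q c i s))) ×-dec
     ×-all? λ i → ×-all? λ j →
       InK? (shift n q c j (shift n q c i s)) →-dec ≡-dec _≟ᶠ_ _≟ᶠ_ j (reverse i))

  covered₁? : ∀ s → Dec (Covered₁ (shift n q c) InK s)
  covered₁? s = InK? s ⊎-dec ×-any? λ i → InK? (shift n q c i s)

  covered₂? : ∀ s → Dec (Covered₂ (shift n q c) InK s)
  covered₂? s = covered₁? s ⊎-dec
    ×-any? λ i → ×-any? λ j → InK? (shift n q c j (shift n q c i s))

  -- The uncovered syndrome is (x , 0) so that the vertex (x , 0 , 0) realises it.
  Admissible : Set
  Admissible = (∀ s → Separated reverse (shift n q c) InK s)
             × (∀ s → Covered₂ (shift n q c) InK s)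
             × (∃ λ (x : Fin n) → ¬ Covered₁ (shift n q c) InK (x , 0 mod q))

  admissible? : Dec Admissible
  admissible? = ×-all? separated? ×-dec ×-all? covered₂? ×-dec
                any? λ x → ¬? (covered₁? (x , 0 mod q))

  admissible⇒code : ∀ l .{{_ : NonZero l}} → n ∣ c * l → q ∣ l → Admissible →
                    HasQuasiPerfect1Code (C n □ C n □ C l)
  admissible⇒code l n∣cl q∣l (sep , cov , x , unc) =
    _ , pullback-quasiPerfect σ InK sep cov
          ((x , 0 mod n , 0 mod l) , subst (λ s → ¬ Covered₁ (shift n q c) InK s) (sym syndrome-x) unc)
    where
    σ : Syndrome (C n □ C n □ C l) Move (Fin n × Fin q)
    σ = linear n q c l n∣cl q∣l
    toℕ-0 : ∀ m .{{_ : NonZero m}} → toℕ (0 mod m) ≡ 0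
    -- `0 mod m` computes only once `m` is visibly a successor.
    toℕ-0 m@(suc _) = refl
    syndrome-x : Syndrome.syn σ (x , 0 mod n , 0 mod l) ≡ (x , 0 mod q)
    syndrome-x = cong₂ _,_
      (trans (cong₂ (λ y z → (toℕ x + 2 * y + c * z) mod n) (toℕ-0 n) (toℕ-0 l))
             (trans (cong (_mod n) (drop-zeros (toℕ x) c)) (toℕ-mod-id x)))
      (cong (_mod q) (toℕ-0 l))
      where
      drop-zeros : ∀ x c → x + 2 * 0 + c * 0 ≡ x
      drop-zeros = solve-∀

-- The codes

-- For `n` = 6 and 8 no residue is at distance at least 3 from both 0 and 3, so layer 0 stays empty;
-- for `n` = 9, 10 and 11 the residue 6 is, and a third layer is filled.
two-layers three-layers : List (ℕ × ℕ)
two-layers   = (0 , 1) ∷ (3 , 2) ∷ []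
three-layers = (0 , 0) ∷ (3 , 1) ∷ (6 , 2) ∷ []

-- With `c` = 0 the condition `n ∣ c * l` holds for every `l`, so one finite check, evaluated during
-- type checking, serves all `k`.
layered-code : ∀ n .{{_ : NonZero n}} K k → {True (admissible? n 3 0 K)} →
               HasQuasiPerfect1Code (C n □ C n □ C (3 * suc k))
layered-code n K k {ok} =
  admissible⇒code n 3 0 K (3 * suc k) (n ∣0) (m∣m*n (suc k)) (toWitness ok)

-- With `q` = 1 there is a single layer, and the code is the kernel of `x + 2y + 3z` modulo `n`.
cubic-code : ∀ n .{{_ : NonZero n}} → {True (admissible? n 1 3 ((0 , 0) ∷ []))} →
             HasQuasiPerfect1Code (C n □ C n □ C n)
cubic-code n {ok} =
  admissible⇒code n 1 3 ((0 , 0) ∷ []) n (n∣m*n 3) (1∣ n) (toWitness ok)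

8≤n≤12-elim : ∀ {p} (P : ℕ → Set p) → P 8 → P 9 → P 10 → P 11 → P 12 → ∀ n → 8 ≤ n → n ≤ 12 → P n
8≤n≤12-elim P p₈ p₉ p₁₀ p₁₁ p₁₂ n 8≤n n≤12 with m≤n⇒∃[o]m+o≡n 8≤n
... | m , refl = go m (+-cancelˡ-≤ 8 m 4 n≤12)
  where
  go : ∀ m → m ≤ 4 → P (8 + m)
  go 0 _ = p₈
  go 1 _ = p₉
  go 2 _ = p₁₀
  go 3 _ = p₁₁
  go 4 _ = p₁₂
  go (suc (suc (suc (suc (suc _))))) (s≤s (s≤s (s≤s (s≤s ()))))

theorem10 : ∀ (k : ℕ) → 1 ≤ k →
    HasQuasiPerfect1Code (C 6 □ C 6 □ C (3 * k))
    × (∀ (n : ℕ) → 8 ≤ n → n ≤ 12 → HasQuasiPerfect1Code (C n □ C n □ C (3 * k)))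
    × (∀ (n : ℕ) → 8 ≤ n → n ≤ 12 → HasQuasiPerfect1Code (C n □ C n □ C n))
theorem10 (suc k) _ =
    layered-code 6 two-layers k
  , 8≤n≤12-elim (λ n → HasQuasiPerfect1Code (C n □ C n □ C (3 * suc k)))
      (layered-code 8 two-layers k)
      (layered-code 9 three-layers k)
      (layered-code 10 three-layers k)
      (layered-code 11 three-layers k)
      -- The code for n = 6, repeated.
      (layered-code 12 ((0 , 1) ∷ (3 , 2) ∷ (6 , 1) ∷ (9 , 2) ∷ []) k)
  , 8≤n≤12-elim (λ n → HasQuasiPerfect1Code (C n □ C n □ C n))
      (cubic-code 8) (cubic-code 9) (cubic-code 10) (cubic-code 11) (cubic-code 12)
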